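{- Let $B=\{011,201\}$, and let $A(x,v)$ and $B(x,v,u)$ be the generating functions defined in the context. The generating function $\sum_{n\geq 0}|I_n(011,201)|\,x^{n+1}$ is equal to $A(x,0)$, and it satisfies $$A(x,0)=\frac{x}{1-2x}+\frac{x^2}{(1-x)^2}\,B\!\left(x,\frac{x}{1-x},1\right).$$
   Context: For $n\ge 0$, $I_n$ denotes the set of inversion sequences $e=e_0e_1\cdots e_n$, i.e. integer sequences with $0\le e_i\le i$ for each $0\le i\le n$. An inversion sequence contains a pattern $\tau$ if it has a (not necessarily consecutive) subsequence order isomorphic to $\tau$ (including equalities); otherwise it avoids $\tau$. $I_n(\tau_1,\dots,\tau_m)$ (also written $I_n(B)$ for $B=\{\tau_1,\dots,\tau_m\}$) is the set of $e\in I_n$ avoiding all $\tau_i$. $\mathcal T(B)$ is the rooted plane tree with root $0$ whose level-$n$ nodes are the elements of $I_n(B)$ (root at level 0), where the parent of $e_0\cdots e_n$ is $e_0\cdots e_{n-1}$ and siblings are ordered left to right by increasing last letter. For a node $e$, $\mathcal T(B;e)$ is the subtree consisting of $e$ and its descendants. The generating function for the number of nodes in $\mathcal T(B;e)$ is the power series in which a node at distance $\ell\ge 0$ below the root $e$ contributes $x^{\ell+1}$. Here $0^m$ is the word of $m$ zeros and $0^mj$ is $0^m$ followed by the letter $j$. Let $A_m(x)$ (for $m\ge1$) and $B_{m,j}(x)$ (for $2\le j\le m$) be the generating functions for the number of nodes in $\mathcal T(B;0^m)$ and $\mathcal T(B;0^mj)$ respectively, and set $$A(x,v)=\sum_{m\ge1}A_m(x)v^{m-1},\qquad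 B(x,v,u)=\sum_{m\ge2}\sum_{j=2}^m B_{m,j}(x)\,v^{m-2}u^{m-j}.$$ -}

module Defs where

open import Data.Fin.Base as Fin using (Fin; toℕ)
import Data.Fin.Properties as Fin
open import Data.Integer.Base as ℤ using (ℤ; +_; 0ℤ; 1ℤ)
import Data.Integer.Properties as ℤ
open import Data.List.Base as List using (List; []; _∷_; cartesianProductWith; filter; length; upTo)
open import Data.List.Membership.Propositional using (_∈_)
open import Data.List.Membership.Propositional.Properties
  using (∈-cartesianProductWith⁺; ∈-cartesianProductWith⁻; ∈-upTo⁺; ∈-upTo⁻)
open import Data.List.Relation.Unary.All as All using (All)
open import Data.List.Relation.Unary.Any using (here)
open import Data.List.Relation.Unary.Unique.Propositional using (Unique)
import Data.List.Relation.Unary.AllPairs as AllPairs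
import Data.List.Relation.Unary.Unique.Propositional.Properties as Unique
open import Data.Nat.Base as ℕ using (ℕ; zero; suc; _∸_; s≤s)
import Data.Nat.Properties as ℕ
open import Data.Product using (∃; _×_; _,_)
open import Data.Vec.Base as Vec using (Vec; []; _∷_; _∷ʳ_; lookup; replicate; init; initLast)
import Data.Vec.Properties as Vec
open import Function.Base using (_∘_)
open import Function.Bundles using (_⇔_; mk⇔; Equivalence)
open import Relation.Binary.PropositionalEquality
open import Relation.Nullary using (¬_; Dec; ¬?; map′; _×-dec_; _→-dec_)
open import Relation.Unary using (Decidable)
open import Algebra.Properties.CommutativeMonoid.Sum ℤ.+-0-commutativeMonoid using (sum)

IsInversionSequence : ∀ {k} → Vec ℕ k → Set
IsInversionSequence e = ∀ i → lookup e i ℕ.≤ toℕ i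

-- The argument is the length, so I_n is drawn from inversionSequences (suc n). Each inversion
-- sequence is listed exactly once: see ∈-inversionSequences and inversionSequences-unique.
inversionSequences : ∀ k → List (Vec ℕ k)
inversionSequences zero    = [] ∷ []
inversionSequences (suc k) = cartesianProductWith _∷ʳ_ (inversionSequences k) (upTo (suc k))

Pattern : Set
Pattern = ∃ (Vec ℕ)

OrderIsomorphic : ∀ {k} → Vec ℕ k → Vec ℕ k → Set
OrderIsomorphic σ τ = ∀ a b →
  (lookup σ a ℕ.< lookup σ b ⇔ lookup τ a ℕ.< lookup τ b) ×
  (lookup σ a ≡ lookup σ b ⇔ lookup τ a ≡ lookup τ b)

StrictlyIncreasing : ∀ {k n} → Vec (Fin n) k → Set
StrictlyIncreasing is = ∀ a b → a Fin.< b → lookup is a Fin.< lookup is b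

Contains : ∀ {n} → Vec ℕ n → Pattern → Set
Contains {n} e (k , τ) = ∃ λ (is : Vec (Fin n) k) →
  StrictlyIncreasing is × OrderIsomorphic (Vec.map (lookup e) is) τ

Avoids : ∀ {n} → List Pattern → Vec ℕ n → Set
Avoids P e = All (λ τ → ¬ Contains e τ) P

_⇔-dec_ : ∀ {A B : Set} → Dec A → Dec B → Dec (A ⇔ B)
a? ⇔-dec b? = map′ (λ (f , g) → mk⇔ f g) (λ e → Equivalence.to e , Equivalence.from e)
  ((a? →-dec b?) ×-dec (b? →-dec a?))

anyVec? : ∀ {n} k {Q : Vec (Fin n) k → Set} → Decidable Q → Dec (∃ Q)
anyVec? zero    Q? = map′ (λ q → [] , q) (λ { ([] , q) → q }) (Q? [])
anyVec? (suc k) Q? = map′ (λ (i , is , q) → i ∷ is , q) (λ { (i ∷ is , q) → i , is , q })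
  (Fin.any? λ i → anyVec? k λ is → Q? (i ∷ is))

orderIsomorphic? : ∀ {k} (σ τ : Vec ℕ k) → Dec (OrderIsomorphic σ τ)
orderIsomorphic? σ τ = Fin.all? λ a → Fin.all? λ b →
  ((lookup σ a ℕ.<? lookup σ b) ⇔-dec (lookup τ a ℕ.<? lookup τ b)) ×-dec
  ((lookup σ a ℕ.≟ lookup σ b) ⇔-dec (lookup τ a ℕ.≟ lookup τ b))

strictlyIncreasing? : ∀ {k n} (is : Vec (Fin n) k) → Dec (StrictlyIncreasing is)
strictlyIncreasing? is = Fin.all? λ a → Fin.all? λ b →
  (a Fin.<? b) →-dec (lookup is a Fin.<? lookup is b)

contains? : ∀ {n} (e : Vec ℕ n) (τ : Pattern) → Dec (Contains e τ)
contains? e (k , τ) = anyVec? k λ is →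
  strictlyIncreasing? is ×-dec orderIsomorphic? (Vec.map (lookup e) is) τ

avoids? : ∀ {n} (P : List Pattern) (e : Vec ℕ n) → Dec (Avoids P e)
avoids? P e = All.all? (λ τ → ¬? (contains? e τ)) P

I : ∀ n → List Pattern → List (Vec ℕ (suc n))
I n P = filter (avoids? P) (inversionSequences (suc n))

-- The generating tree: the nodes of level n are the elements of I n P, and the parent
-- of e is init e.

ancestor : ∀ ℓ {n} → Vec ℕ (suc (ℓ ℕ.+ n)) → Vec ℕ (suc n)
ancestor zero    e = e
ancestor (suc ℓ) e = ancestor ℓ (init e)

descendants : ∀ {n} → List Pattern → Vec ℕ (suc n) → ∀ ℓ → List (Vec ℕ (suc (ℓ ℕ.+ n)))
descendants {n} P e ℓ = filter (λ d → Vec.≡-dec ℕ._≟_ (ancestor ℓ d) e) (I (ℓ ℕ.+ n) P)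

-- Formal power series in x with integer coefficients; equality is _≗_.

Series : Set
Series = ℕ → ℤ

infixl 6 _+_ _-_
infixl 7 _*_ _/_
infixr 8 _^_

const : ℤ → Series
const c zero    = c
const c (suc n) = 0ℤ

X : Series
X zero          = 0ℤ
X (suc zero)    = 1ℤ
X (suc (suc n)) = 0ℤ

_+_ _-_ _*_ _/_ : Series → Series → Series
(f + g) n = f n ℤ.+ g n
(f - g) n = f n ℤ.- g n
(f * g) n = sum {suc n} λ i → f (toℕ i) ℤ.* g (n ∸ toℕ i)

-- Long division; this is the quotient only when g has constant term 1 (see /-* below).
(f / g) zero    = f zero
(f / g) (suc n) = ((λ m → f (suc m) ℤ.- f zero ℤ.* g (suc m)) / g) n

_^_ : Series → ℕ → Series
f ^ zero  = const 1ℤ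
f ^ suc k = f * f ^ k

-- A power series in v over Series, given by its coefficients F k of v^k, evaluated at v = g.
-- Requires g to have constant term 0: then g ^ k has no terms below x^k, so the terms with
-- k > n do not contribute to the coefficient of x^n.
evalSeries : (ℕ → Series) → Series → Series
evalSeries F g n = sum {suc n} λ k → (F (toℕ k) * g ^ toℕ k) n

-- A polynomial in u over Series (constant coefficient first), evaluated at u = g.
evalPoly : List Series → Series → Series
evalPoly cs g = List.foldr (λ c r → c + g * r) (const 0ℤ) cs

-- Σ_{n ≥ 0} a n x^{n+1}
gf : (ℕ → ℕ) → Series
gf a zero    = 0ℤ
gf a (suc n) = + a n

subtreeGF : ∀ {n} → List Pattern → Vec ℕ (suc n) → Series
subtreeGF P e = gf λ ℓ → length (descendants P e ℓ)

-- The coefficient of v^k in A(x,v) is A_{k+1}(x).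
A : List Pattern → ℕ → Series
A P k = subtreeGF P (replicate (suc k) 0)

Bₘⱼ : List Pattern → ℕ → ℕ → Series
Bₘⱼ P m j = subtreeGF P (replicate m 0 ∷ʳ j)

-- The coefficient of v^k in B(x,v,u), with k = m - 2, is the polynomial in u whose
-- coefficients of u^i, with i = m - j and so 0 ≤ i ≤ k, are B_{k+2,k+2-i}(x).
B : List Pattern → ℕ → List Series
B P k = List.map (λ i → Bₘⱼ P (2 ℕ.+ k) (2 ℕ.+ k ∸ i)) (upTo (suc k))

lookup-∷ʳ-≤ : ∀ (b : ℕ → ℕ) {k} (e : Vec ℕ k) j →
  (∀ i → lookup (e ∷ʳ j) i ℕ.≤ b (toℕ i)) ⇔ ((∀ i → lookup e i ℕ.≤ b (toℕ i)) × j ℕ.≤ b k)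
lookup-∷ʳ-≤ b []      j = mk⇔ (λ h → (λ ()) , h Fin.zero) λ { (_ , h) Fin.zero → h }
lookup-∷ʳ-≤ b (x ∷ e) j = mk⇔
  (λ h → let p , q = R.to (h ∘ Fin.suc) in (λ { Fin.zero → h Fin.zero ; (Fin.suc i) → p i }) , q)
  (λ { (p , q) Fin.zero → p Fin.zero ; (p , q) (Fin.suc i) → R.from (p ∘ Fin.suc , q) i })
  where module R = Equivalence (lookup-∷ʳ-≤ (b ∘ suc) e j)

∈-inversionSequences : ∀ {k} (e : Vec ℕ k) → e ∈ inversionSequences k ⇔ IsInversionSequence e
∈-inversionSequences {zero}  []        = mk⇔ (λ _ ()) (λ _ → here refl)
∈-inversionSequences {suc k} e = mk⇔ to from
  where
  to : e ∈ inversionSequences (suc k) → IsInversionSequence e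
  to h with ∈-cartesianProductWith⁻ _∷ʳ_ (inversionSequences k) (upTo (suc k)) h
  ... | d , j , p , q , refl = Equivalence.from (lookup-∷ʳ-≤ (λ i → i) d j)
    (Equivalence.to (∈-inversionSequences d) p , ℕ.≤-pred (∈-upTo⁻ q))
  from : IsInversionSequence e → e ∈ inversionSequences (suc k)
  from h with initLast e
  ... | d , j , refl with Equivalence.to (lookup-∷ʳ-≤ (λ i → i) d j) h
  ...   | p , q = ∈-cartesianProductWith⁺ _∷ʳ_ (Equivalence.from (∈-inversionSequences d) p) (∈-upTo⁺ (s≤s q))

inversionSequences-unique : ∀ k → Unique (inversionSequences k)
inversionSequences-unique zero    = All.[] AllPairs.∷ AllPairs.[]
inversionSequences-unique (suc k) = Unique.cartesianProductWith⁺ _∷ʳ_ (Vec.∷ʳ-injective _ _)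
  (inversionSequences-unique k) (Unique.upTo⁺ (suc k))

/-* : ∀ f g → g 0 ≡ 1ℤ → (f / g) * g ≗ f
/-* f g g₀ zero rewrite g₀ = trans (ℤ.+-identityʳ _) (ℤ.*-identityʳ (f 0))
/-* f g g₀ (suc n) = begin
  f 0 ℤ.* g (suc n) ℤ.+ ((f′ / g) * g) n                   ≡⟨ cong (λ z → f 0 ℤ.* g (suc n) ℤ.+ z) (/-* f′ g g₀ n) ⟩
  f 0 ℤ.* g (suc n) ℤ.+ (f (suc n) ℤ.- f 0 ℤ.* g (suc n))  ≡⟨ ℤ.+-comm (f 0 ℤ.* g (suc n)) _ ⟩
  f (suc n) ℤ.- f 0 ℤ.* g (suc n) ℤ.+ f 0 ℤ.* g (suc n)    ≡⟨ ℤ.+-assoc (f (suc n)) _ _ ⟩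
  f (suc n) ℤ.+ (ℤ.- (f 0 ℤ.* g (suc n)) ℤ.+ f 0 ℤ.* g (suc n)) ≡⟨ cong (λ z → f (suc n) ℤ.+ z) (ℤ.+-inverseˡ (f 0 ℤ.* g (suc n))) ⟩
  f (suc n) ℤ.+ 0ℤ                                         ≡⟨ ℤ.+-identityʳ _ ⟩
  f (suc n)                                                ∎
  where
  open ≡-Reasoning
  f′ : Series
  f′ m = f (suc m) ℤ.- f 0 ℤ.* g (suc m)

module Submission where

-- Write 0^m for the word of m zeros. Its children in the tree are the words 0^m j with j at most m.
-- The child with j = 0 is 0^(m+1). The subtree of the child 0^m 1 is isomorphic to that of 0^m: insert
-- a letter 1 after the first m zeros, and raise every positive letter by one (extend-raised). A further
-- letter 1 below 0^m 1 would complete an occurrence of 011, so every node below 0^m 1 arises in this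
-- way, and the inserted 1 takes part in no new obstruction: in an occurrence of 011 it could only be
-- the first letter, where a leading 0 serves as well, and in an occurrence of 201 it cannot be the
-- largest letter, nor can it be a later one, as it follows only zeros. Hence, with S_m the sum of
-- B_(m,j) over j from 2 to m,
--
--   A_m = x (1 + S_m + A_(m+1) + A_m),  that is,  A_m = y (1 + S_m + A_(m+1))  with  y = x/(1-x).
--
-- The series t = x/(1-2x) satisfies t = y (1 + t), and E_m, the sum of S_(m+k) y^k over k, satisfies
-- E_m = S_m + y E_(m+1) (evalSeries-horner). So t + y E_m solves the same equations as A_m. As y has
-- no constant term, these determine all the coefficients (guarded-unique), and A_m = t + y E_m. For
-- m = 1 the sum S_1 is empty, whence A_1 = t + y^2 E_2, where E_2 = B(x,y,1).
--
-- The levels of a subtree are counted by iterating the sum over the children of a word (extend);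
-- length-descendants identifies this with the number of descendants in the tree.

open import Defs
open import Algebra.Bundles using (CommutativeSemiring)
import Algebra.Properties.CommutativeMonoid.Sum as MonoidSum
import Algebra.Properties.Semiring.Sum as SemiringSum
import Algebra.Solver.Ring.NaturalCoefficients.Default as SemiringSolver
import Algebra.Structures.Biased as Biased
open import Data.Bool.Base using (if_then_else_; true; false)
open import Data.Fin.Base using (Fin; zero; suc; toℕ)
open import Data.Integer.Base as ℤ using (ℤ; +_; 0ℤ; 1ℤ)
import Data.Integer.Properties as ℤ
open import Data.Integer.Tactic.RingSolver using (solve-∀)
open import Data.List.Base as List using (List; []; _∷_; length; filter; applyUpTo; applyDownFrom; upTo; cartesianProductWith)
import Data.List.Properties as List
open import Data.List.Membership.Propositional using (_∈_)
open import Data.List.Relation.Binary.Permutation.Propositional.Properties using (↭-reverse)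
open import Data.List.Relation.Binary.Sublist.Propositional using (_⊆_; ⊆-refl; ⊆-trans; minimum; []; _∷_) renaming (_∷ʳ_ to skip)
open import Data.List.Relation.Binary.Sublist.Propositional.Properties using (++⁺; ++⁺ʳ; map⁺; ∷ˡ⁻)
open import Data.List.Relation.Unary.All as All using (All; []; _∷_)
open import Data.List.Relation.Unary.AllPairs using (_∷_)
open import Data.List.Relation.Unary.Any using (here; there)
open import Data.List.Relation.Unary.Unique.Propositional using (Unique)
open import Data.Nat.Base as ℕ using (ℕ; zero; suc; _<_; _≤_; _∸_; z≤n; s≤s; z<s; s≤s⁻¹)
import Data.Nat.ListAction as ℕ
import Data.Nat.ListAction.Properties as ℕ
import Data.Nat.Properties as ℕ
open import Data.Product using (∃; _×_; _,_; proj₁; proj₂)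
open import Data.Vec.Base as Vec using (Vec; []; _∷_; _∷ʳ_; lookup; toList; replicate; init)
import Data.Vec.Properties as Vec
open import Function.Base using (_∘_; id)
open import Function.Bundles using (_⇔_; mk⇔; Equivalence)
open import Level using (0ℓ)
import Relation.Binary.Reasoning.Setoid as SetoidReasoning
open import Relation.Binary.PropositionalEquality
open import Relation.Binary.Structures using (IsEquivalence)
open import Relation.Nullary using (¬_; Dec; does; contradiction)
open import Relation.Nullary.Decidable using (dec-true; dec-false; does-⇔)
open import Relation.Unary using (Decidable)

open MonoidSum ℤ.+-0-commutativeMonoid using (sum; sum-cong-≗; ∑-distrib-+; ∑-comm; sum-replicate-zero)
open SemiringSum ℤ.+-*-semiring using (*-distribˡ-sum)

-- Weighted counting in lists

indicator : {A : Set} → Dec A → ℕ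
indicator a? = if does a? then 1 else 0

indicator-yes : {A : Set} (a? : Dec A) → A → indicator a? ≡ 1
indicator-yes a? a = cong (if_then 1 else 0) (dec-true a? a)

indicator-no : {A : Set} (a? : Dec A) → ¬ A → indicator a? ≡ 0
indicator-no a? ¬a = cong (if_then 1 else 0) (dec-false a? ¬a)

indicator-⇔ : {A B : Set} (a? : Dec A) (b? : Dec B) → A ⇔ B → indicator a? ≡ indicator b?
indicator-⇔ a? b? A⇔B = cong (if_then 1 else 0) (does-⇔ A⇔B a? b?)

sumOver : {A : Set} → List A → (A → ℕ) → ℕ
sumOver xs f = ℕ.sum (List.map f xs)

sumOver-cong : {A : Set} {f g : A → ℕ} → f ≗ g → ∀ xs → sumOver xs f ≡ sumOver xs g
sumOver-cong eq xs = cong ℕ.sum (List.map-cong eq xs)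

*-distribʳ-sumOver : {A : Set} (f : A → ℕ) (c : ℕ) (xs : List A) → sumOver xs (λ x → f x ℕ.* c) ≡ sumOver xs f ℕ.* c
*-distribʳ-sumOver f c []       = refl
*-distribʳ-sumOver f c (x ∷ xs) = trans (cong (f x ℕ.* c ℕ.+_) (*-distribʳ-sumOver f c xs)) (sym (ℕ.*-distribʳ-+ c (f x) (sumOver xs f)))

sumOver-filter : {A : Set} {P : A → Set} (P? : Decidable P) (f : A → ℕ) (xs : List A) →
  sumOver (filter P? xs) f ≡ sumOver xs λ x → indicator (P? x) ℕ.* f x
sumOver-filter P? f []       = refl
sumOver-filter P? f (x ∷ xs) with does (P? x)
... | true  = cong₂ ℕ._+_ (sym (ℕ.+-identityʳ (f x))) (sumOver-filter P? f xs)
... | false = sumOver-filter P? f xs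

length-filter : {A : Set} {P : A → Set} (P? : Decidable P) (xs : List A) →
  length (filter P? xs) ≡ sumOver xs (indicator ∘ P?)
length-filter P? []       = refl
length-filter P? (x ∷ xs) with does (P? x)
... | true  = cong suc (length-filter P? xs)
... | false = length-filter P? xs

sumOver-cartesianProductWith : {A B C : Set} (f : A → B → C) (φ : C → ℕ) (xs : List A) (ys : List B) →
  sumOver (cartesianProductWith f xs ys) φ ≡ sumOver xs λ x → sumOver ys λ y → φ (f x y)
sumOver-cartesianProductWith f φ []       ys = refl
sumOver-cartesianProductWith f φ (x ∷ xs) ys = begin
  ℕ.sum (List.map φ (List.map (f x) ys List.++ cartesianProductWith f xs ys))
    ≡⟨ cong ℕ.sum (List.map-++ φ (List.map (f x) ys) _) ⟩
  ℕ.sum (List.map φ (List.map (f x) ys) List.++ List.map φ (cartesianProductWith f xs ys))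
    ≡⟨ ℕ.sum-++ (List.map φ (List.map (f x) ys)) _ ⟩
  ℕ.sum (List.map φ (List.map (f x) ys)) ℕ.+ sumOver (cartesianProductWith f xs ys) φ
    ≡⟨ cong₂ ℕ._+_ (cong ℕ.sum (sym (List.map-∘ ys))) (sumOver-cartesianProductWith f φ xs ys) ⟩
  sumOver ys (φ ∘ f x) ℕ.+ sumOver xs (λ x → sumOver ys λ y → φ (f x y))
    ∎
  where open ≡-Reasoning

sumOver-≡ : {A : Set} (_≟_ : (x y : A) → Dec (x ≡ y)) (f : A → ℕ) {e : A} {xs : List A} →
  Unique xs → e ∈ xs → sumOver xs (λ x → f x ℕ.* indicator (x ≟ e)) ≡ f e
sumOver-≡ _≟_ f {e} {_ ∷ xs} (e∉xs ∷ _) (here refl) = begin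
  f e ℕ.* indicator (e ≟ e) ℕ.+ sumOver xs (λ x → f x ℕ.* indicator (x ≟ e))
    ≡⟨ cong₂ (λ i s → f e ℕ.* i ℕ.+ s) (indicator-yes (e ≟ e) refl) (others e∉xs) ⟩
  f e ℕ.* 1 ℕ.+ 0
    ≡⟨ trans (ℕ.+-identityʳ _) (ℕ.*-identityʳ (f e)) ⟩
  f e
    ∎
  where
  open ≡-Reasoning
  others : ∀ {xs} → All (e ≢_) xs → sumOver xs (λ x → f x ℕ.* indicator (x ≟ e)) ≡ 0
  others []                 = refl
  others {x ∷ _} (e≢x ∷ ps) = cong₂ ℕ._+_ (trans (cong (f x ℕ.*_) (indicator-no (x ≟ e) (e≢x ∘ sym))) (ℕ.*-zeroʳ (f x))) (others ps)
sumOver-≡ _≟_ f {e} {x ∷ xs} (x∉xs ∷ u) (there e∈xs) = cong₂ ℕ._+_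
  (trans (cong (f x ℕ.*_) (indicator-no (x ≟ e) (All.lookup x∉xs e∈xs))) (ℕ.*-zeroʳ (f x)))
  (sumOver-≡ _≟_ f u e∈xs)

-- The sum of f j over j < n.
∑< : ℕ → (ℕ → ℕ) → ℕ
∑< n f = ℕ.sum (applyUpTo f n)

∑<-cong : ∀ n {f g} → f ≗ g → ∑< n f ≡ ∑< n g
∑<-cong zero    eq = refl
∑<-cong (suc n) eq = cong₂ ℕ._+_ (eq 0) (∑<-cong n (eq ∘ suc))

∑<-zero : ∀ n {f} → (∀ j → f j ≡ 0) → ∑< n f ≡ 0
∑<-zero zero    eq = refl
∑<-zero (suc n) eq = cong₂ ℕ._+_ (eq 0) (∑<-zero n (eq ∘ suc))

-- The summation index j is replaced by n - i; the offset 2 matches the letters from 2 to 2 + n.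
∑<-reverse : ∀ (f : ℕ → ℕ) n → ∑< (suc n) (λ i → f (2 ℕ.+ n ∸ i)) ≡ ∑< (suc n) (λ j → f (2 ℕ.+ j))
∑<-reverse f n = begin
  ℕ.sum (applyUpTo (λ i → f (2 ℕ.+ n ∸ i)) (suc n))                 ≡⟨ cong ℕ.sum (downwards n) ⟩
  ℕ.sum (applyDownFrom (λ j → f (2 ℕ.+ j)) (suc n))                 ≡⟨ cong ℕ.sum (List.reverse-applyUpTo (λ j → f (2 ℕ.+ j)) (suc n)) ⟨
  ℕ.sum (List.reverse (applyUpTo (λ j → f (2 ℕ.+ j)) (suc n)))      ≡⟨ ℕ.sum-↭ (↭-reverse (applyUpTo (λ j → f (2 ℕ.+ j)) (suc n))) ⟩
  ℕ.sum (applyUpTo (λ j → f (2 ℕ.+ j)) (suc n))                     ∎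
  where
  open ≡-Reasoning
  downwards : ∀ n → applyUpTo (λ i → f (2 ℕ.+ n ∸ i)) (suc n) ≡ applyDownFrom (λ j → f (2 ℕ.+ j)) (suc n)
  downwards zero    = refl
  downwards (suc n) = cong (f (3 ℕ.+ n) ∷_) (downwards n)

-- Counting descendants level by level

-- A function on words of every length.
Weight : Set
Weight = ∀ {k} → Vec ℕ k → ℕ

-- The sum of φ over the words extending e by a letter that keeps it an inversion sequence: the new
-- letter is in position k, the length of e, so it ranges over 0, ..., k.
children : Weight → Weight
children φ {k} e = ∑< (suc k) λ j → φ (e ∷ʳ j)

-- The sum of φ over the words extending e by ℓ letters in this way. Nothing is required of e itself.
extend : Weight → ℕ → Weight
extend φ zero    e = φ e
extend φ (suc ℓ) e = children (extend φ ℓ) e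

-- The letters of an extension are chosen from the first to the last in extend, whereas the list of
-- inversion sequences is built by choosing the last letter last; this lemma exchanges the two.
extend-children : ∀ (φ : Weight) ℓ {k} (e : Vec ℕ k) → extend (children φ) ℓ e ≡ extend φ (suc ℓ) e
extend-children φ zero        e = refl
extend-children φ (suc ℓ) {k} e = ∑<-cong (suc k) λ j → extend-children φ ℓ (e ∷ʳ j)

sumOver-snoc : ∀ k (φ : Vec ℕ (suc k) → ℕ) →
  sumOver (inversionSequences (suc k)) φ ≡ sumOver (inversionSequences k) λ e → ∑< (suc k) λ j → φ (e ∷ʳ j)
sumOver-snoc k φ = trans
  (sumOver-cartesianProductWith _∷ʳ_ φ (inversionSequences k) (upTo (suc k)))
  (sumOver-cong (λ e → cong ℕ.sum (List.map-upTo (λ j → φ (e ∷ʳ j)) (suc k))) (inversionSequences k))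

sumOver-inversionSequences : ∀ (φ : Weight) k → sumOver (inversionSequences k) φ ≡ extend φ k []
sumOver-inversionSequences φ zero    = ℕ.+-identityʳ _
sumOver-inversionSequences φ (suc k) = begin
  sumOver (inversionSequences (suc k)) φ       ≡⟨ sumOver-snoc k φ ⟩
  sumOver (inversionSequences k) (children φ)  ≡⟨ sumOver-inversionSequences (children φ) k ⟩
  extend (children φ) k []                     ≡⟨ extend-children φ k [] ⟩
  extend φ (suc k) []                          ∎
  where open ≡-Reasoning

_≟ᵛ_ : ∀ {k} (d e : Vec ℕ k) → Dec (d ≡ e)
_≟ᵛ_ = Vec.≡-dec ℕ._≟_

sumOver-descendants : ∀ (φ : Weight) ℓ {n} (e : Vec ℕ (suc n)) → e ∈ inversionSequences (suc n) →
  sumOver (inversionSequences (suc (ℓ ℕ.+ n))) (λ d → φ d ℕ.* indicator (ancestor ℓ d ≟ᵛ e)) ≡ extend φ ℓ e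
sumOver-descendants φ zero    {n} e e∈ = sumOver-≡ _≟ᵛ_ φ (inversionSequences-unique (suc n)) e∈
sumOver-descendants φ (suc ℓ) {n} e e∈ = begin
  sumOver (inversionSequences (2 ℕ.+ ℓ ℕ.+ n)) (λ d → φ d ℕ.* indicator (ancestor ℓ (init d) ≟ᵛ e))
    ≡⟨ sumOver-snoc (suc (ℓ ℕ.+ n)) _ ⟩
  sumOver (inversionSequences (suc ℓ ℕ.+ n)) (λ d → ∑< (2 ℕ.+ ℓ ℕ.+ n) λ j → φ (d ∷ʳ j) ℕ.* indicator (ancestor ℓ (init (d ∷ʳ j)) ≟ᵛ e))
    ≡⟨ sumOver-cong factor (inversionSequences (suc ℓ ℕ.+ n)) ⟩
  sumOver (inversionSequences (suc ℓ ℕ.+ n)) (λ d → children φ d ℕ.* indicator (ancestor ℓ d ≟ᵛ e))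
    ≡⟨ sumOver-descendants (children φ) ℓ e e∈ ⟩
  extend (children φ) ℓ e
    ≡⟨ extend-children φ ℓ e ⟩
  extend φ (suc ℓ) e
    ∎
  where
  open ≡-Reasoning
  factor : ∀ d → ∑< (2 ℕ.+ ℓ ℕ.+ n) (λ j → φ (d ∷ʳ j) ℕ.* indicator (ancestor ℓ (init (d ∷ʳ j)) ≟ᵛ e)) ≡
    children φ d ℕ.* indicator (ancestor ℓ d ≟ᵛ e)
  factor d = begin
    ∑< (2 ℕ.+ ℓ ℕ.+ n) (λ j → φ (d ∷ʳ j) ℕ.* indicator (ancestor ℓ (init (d ∷ʳ j)) ≟ᵛ e))
      ≡⟨ ∑<-cong (2 ℕ.+ ℓ ℕ.+ n) (λ j → cong (λ d′ → φ (d ∷ʳ j) ℕ.* indicator (ancestor ℓ d′ ≟ᵛ e)) (Vec.init-∷ʳ j d)) ⟩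
    ∑< (2 ℕ.+ ℓ ℕ.+ n) (λ j → φ (d ∷ʳ j) ℕ.* i)
      ≡⟨ cong ℕ.sum (List.map-upTo (λ j → φ (d ∷ʳ j) ℕ.* i) (2 ℕ.+ ℓ ℕ.+ n)) ⟨
    sumOver (upTo (2 ℕ.+ ℓ ℕ.+ n)) (λ j → φ (d ∷ʳ j) ℕ.* i)
      ≡⟨ *-distribʳ-sumOver (λ j → φ (d ∷ʳ j)) i (upTo (2 ℕ.+ ℓ ℕ.+ n)) ⟩
    sumOver (upTo (2 ℕ.+ ℓ ℕ.+ n)) (λ j → φ (d ∷ʳ j)) ℕ.* i
      ≡⟨ cong (λ s → ℕ.sum s ℕ.* i) (List.map-upTo (λ j → φ (d ∷ʳ j)) (2 ℕ.+ ℓ ℕ.+ n)) ⟩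
    children φ d ℕ.* i
      ∎
    where
    i : ℕ
    i = indicator (ancestor ℓ d ≟ᵛ e)

-- Testing the final word of an extension suffices: if it avoids the patterns, so do its ancestors.
avoiding : List Pattern → Weight
avoiding P e = indicator (avoids? P e)

length-descendants : ∀ P {n} (e : Vec ℕ (suc n)) → IsInversionSequence e → ∀ ℓ →
  length (descendants P e ℓ) ≡ extend (avoiding P) ℓ e
length-descendants P {n} e inv ℓ = begin
  length (descendants P e ℓ)
    ≡⟨ length-filter (λ d → ancestor ℓ d ≟ᵛ e) (I (ℓ ℕ.+ n) P) ⟩
  sumOver (I (ℓ ℕ.+ n) P) (λ d → indicator (ancestor ℓ d ≟ᵛ e))
    ≡⟨ sumOver-filter (avoids? P) (λ d → indicator (ancestor ℓ d ≟ᵛ e)) (inversionSequences (suc (ℓ ℕ.+ n))) ⟩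
  sumOver (inversionSequences (suc (ℓ ℕ.+ n))) (λ d → avoiding P d ℕ.* indicator (ancestor ℓ d ≟ᵛ e))
    ≡⟨ sumOver-descendants (avoiding P) ℓ e (Equivalence.from (∈-inversionSequences e) inv) ⟩
  extend (avoiding P) ℓ e
    ∎
  where open ≡-Reasoning

length-I : ∀ P n → length (I n P) ≡ extend (avoiding P) n (0 ∷ [])
length-I P n = begin
  length (I n P)                                        ≡⟨ length-filter (avoids? P) (inversionSequences (suc n)) ⟩
  sumOver (inversionSequences (suc n)) (avoiding P)     ≡⟨ sumOver-inversionSequences (avoiding P) (suc n) ⟩
  extend (avoiding P) n (0 ∷ []) ℕ.+ 0                    ≡⟨ ℕ.+-identityʳ _ ⟩
  extend (avoiding P) n (0 ∷ [])                        ∎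
  where open ≡-Reasoning

-- Pattern occurrences as sublists

-- Containment in terms of the letters of an occurrence, in place of their positions.
Occurs : List ℕ → Pattern → Set
Occurs l (k , τ) = ∃ λ (σ : Vec ℕ k) → toList σ ⊆ l × OrderIsomorphic σ τ

positive⇒map-suc : ∀ {n k} (is : Vec (Fin (suc n)) k) → (∀ a → 0 < toℕ (lookup is a)) →
  ∃ λ js → is ≡ Vec.map suc js
positive⇒map-suc []           _   = [] , refl
positive⇒map-suc (zero  ∷ is) pos = contradiction (pos zero) λ ()
positive⇒map-suc (suc i ∷ is) pos with positive⇒map-suc is (pos ∘ suc)
... | js , refl = i ∷ js , refl

map-suc-increasing⁻ : ∀ {n k} (js : Vec (Fin n) k) → StrictlyIncreasing (Vec.map suc js) → StrictlyIncreasing js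
map-suc-increasing⁻ js inc a b a<b = s≤s⁻¹ (subst₂ (λ i j → toℕ i < toℕ j) (Vec.lookup-map a suc js) (Vec.lookup-map b suc js) (inc a b a<b))

map-suc-increasing⁺ : ∀ {n k} (js : Vec (Fin n) k) → StrictlyIncreasing js → StrictlyIncreasing (Vec.map suc js)
map-suc-increasing⁺ js inc a b a<b = subst₂ (λ i j → toℕ i < toℕ j) (sym (Vec.lookup-map a suc js)) (sym (Vec.lookup-map b suc js)) (s≤s (inc a b a<b))

increasing⇒⊆ : ∀ {n k} (e : Vec ℕ n) (is : Vec (Fin n) k) → StrictlyIncreasing is →
  toList (Vec.map (lookup e) is) ⊆ toList e
increasing⇒⊆ e       []           inc = minimum _
increasing⇒⊆ (x ∷ e) (zero ∷ is)  inc with positive⇒map-suc is (λ a → inc zero (suc a) (s≤s z≤n))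
... | js , refl = refl ∷ subst (λ v → toList v ⊆ toList e) (Vec.map-∘ (lookup (x ∷ e)) suc js)
  (increasing⇒⊆ e js (map-suc-increasing⁻ js λ a b a<b → inc (suc a) (suc b) (s≤s a<b)))
increasing⇒⊆ (x ∷ e) (suc i ∷ is) inc with positive⇒map-suc is (λ a → ℕ.≤-<-trans z≤n (inc zero (suc a) (s≤s z≤n)))
... | js , refl = skip x (subst (λ v → toList v ⊆ toList e) (Vec.map-∘ (lookup (x ∷ e)) suc (i ∷ js))
  (increasing⇒⊆ e (i ∷ js) (map-suc-increasing⁻ (i ∷ js) inc)))

⊆⇒increasing : ∀ {n k} (e : Vec ℕ n) (σ : Vec ℕ k) → toList σ ⊆ toList e →
  ∃ λ is → StrictlyIncreasing is × Vec.map (lookup e) is ≡ σ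
⊆⇒increasing e       []      _          = [] , (λ ()) , refl
⊆⇒increasing (x ∷ e) (s ∷ σ) (skip _ p) with ⊆⇒increasing e (s ∷ σ) p
... | is , inc , eq = Vec.map suc is , map-suc-increasing⁺ is inc , trans (sym (Vec.map-∘ (lookup (x ∷ e)) suc is)) eq
⊆⇒increasing (x ∷ e) (x ∷ σ) (refl ∷ p) with ⊆⇒increasing e σ p
... | is , inc , eq = zero ∷ Vec.map suc is , inc′ , cong (x ∷_) (trans (sym (Vec.map-∘ (lookup (x ∷ e)) suc is)) eq)
  where
  inc′ : StrictlyIncreasing (zero ∷ Vec.map suc is)
  inc′ zero    (suc b) _   = subst (λ i → 0 < toℕ i) (sym (Vec.lookup-map b suc is)) (s≤s z≤n)
  inc′ (suc a) (suc b) a<b = map-suc-increasing⁺ is inc a b (s≤s⁻¹ a<b)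

contains⇔occurs : ∀ {n} (e : Vec ℕ n) τ → Contains e τ ⇔ Occurs (toList e) τ
contains⇔occurs e (k , τ) = mk⇔
  (λ (is , inc , iso) → Vec.map (lookup e) is , increasing⇒⊆ e is inc , iso)
  from
  where
  from : Occurs (toList e) (k , τ) → Contains e (k , τ)
  from (σ , σ⊆e , iso) with ⊆⇒increasing e σ σ⊆e
  ... | is , inc , refl = is , inc , iso

occurs-mono : ∀ {l l′} τ → l ⊆ l′ → Occurs l τ → Occurs l′ τ
occurs-mono τ l⊆l′ (σ , σ⊆l , iso) = σ , ⊆-trans σ⊆l l⊆l′ , iso

toList-∷ʳ : ∀ {n} (e : Vec ℕ n) j → toList (e ∷ʳ j) ≡ toList e List.++ j ∷ []
toList-∷ʳ []      j = refl
toList-∷ʳ (x ∷ e) j = cong (x ∷_) (toList-∷ʳ e j)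

-- A word containing a forbidden pattern has no avoiding descendants.
extend-occurs : ∀ P {τ} → τ ∈ P → ∀ ℓ {n} (e : Vec ℕ n) → Occurs (toList e) τ → extend (avoiding P) ℓ e ≡ 0
extend-occurs P {τ} τ∈P zero    e occ = indicator-no (avoids? P e)
  λ avoids → All.lookup avoids τ∈P (Equivalence.from (contains⇔occurs e τ) occ)
extend-occurs P {τ} τ∈P (suc ℓ) {n} e occ = ∑<-zero (suc n) λ j → extend-occurs P τ∈P ℓ (e ∷ʳ j)
  (occurs-mono τ (subst (toList e ⊆_) (sym (toList-∷ʳ e j)) (++⁺ʳ (j ∷ []) ⊆-refl)) occ)

-- Inserting a letter 1

-- The order embedding of ℕ into itself that fixes 0 and omits only the value 1.
up : ℕ → ℕ
up zero    = zero
up (suc n) = suc (suc n)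

up-<⁺ : ∀ {a b} → a < b → up a < up b
up-<⁺ {zero}  {suc b} _         = s≤s z≤n
up-<⁺ {suc a} {suc b} (s≤s a<b) = s≤s (s≤s a<b)

up-<⁻ : ∀ {a b} → up a < up b → a < b
up-<⁻ {zero}  {suc b} _               = s≤s z≤n
up-<⁻ {suc a} {suc b} (s≤s (s≤s a<b)) = s≤s a<b

up-injective : ∀ {a b} → up a ≡ up b → a ≡ b
up-injective {zero}  {zero}  _    = refl
up-injective {suc a} {suc b} refl = refl

up≢1 : ∀ a → up a ≢ 1
up≢1 zero    ()
up≢1 (suc a) ()

map-up-iso : ∀ {k} (σ τ : Vec ℕ k) → OrderIsomorphic (Vec.map up σ) τ ⇔ OrderIsomorphic σ τ
map-up-iso σ τ = mk⇔ to from
  where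
  open Equivalence using () renaming (to to apply; from to unapply)
  to : OrderIsomorphic (Vec.map up σ) τ → OrderIsomorphic σ τ
  to iso a b with iso a b
  ... | lt , eq rewrite Vec.lookup-map a up σ | Vec.lookup-map b up σ =
    mk⇔ (λ p → apply lt (up-<⁺ p)) (λ p → up-<⁻ (unapply lt p)) ,
    mk⇔ (λ p → apply eq (cong up p)) (λ p → up-injective (unapply eq p))
  from : OrderIsomorphic σ τ → OrderIsomorphic (Vec.map up σ) τ
  from iso a b with iso a b
  ... | lt , eq rewrite Vec.lookup-map a up σ | Vec.lookup-map b up σ =
    mk⇔ (λ p → apply lt (up-<⁻ p)) (λ p → up-<⁺ (unapply lt p)) ,
    mk⇔ (λ p → apply eq (up-injective p)) (λ p → cong up (unapply eq p))

⊆-map⁻ : ∀ {k} (σ : Vec ℕ k) (f : ℕ → ℕ) l → toList σ ⊆ List.map f l → ∃ λ ρ → σ ≡ Vec.map f ρ × toList ρ ⊆ l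
⊆-map⁻ []      f l       _          = [] , refl , minimum l
⊆-map⁻ (s ∷ σ) f (x ∷ l) (skip _ p) with ⊆-map⁻ (s ∷ σ) f l p
... | ρ , eq , q = ρ , eq , skip x q
⊆-map⁻ (s ∷ σ) f (x ∷ l) (eq ∷ p) with ⊆-map⁻ σ f l p
... | ρ , refl , q = x ∷ ρ , cong (_∷ Vec.map f ρ) eq , refl ∷ q

drop-1 : ∀ {xs} as {bs} → All (_≢ 1) xs → xs ⊆ as List.++ 1 ∷ bs → xs ⊆ as List.++ bs
drop-1 []       _        (skip _ p)  = p
drop-1 []       (≢1 ∷ _) (refl ∷ _)  = contradiction refl ≢1
drop-1 (a ∷ as) all      (skip _ p)  = skip a (drop-1 as all p)
drop-1 (a ∷ as) (_ ∷ all) (refl ∷ p) = refl ∷ drop-1 as all p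

zeros : ℕ → List ℕ
zeros m = List.replicate m 0

1∉map-up : ∀ {xs} w → ¬ (1 ∷ xs ⊆ List.map up w)
1∉map-up (x ∷ w) (skip _ p) = 1∉map-up w p
1∉map-up (x ∷ w) (eq ∷ _)   = up≢1 x (sym eq)

-- The letter 1 occurs once in the word, after zeros only.
before-1 : ∀ m w {c xs} → c ∷ 1 ∷ xs ⊆ zeros m List.++ 1 ∷ List.map up w → c ≡ 0
before-1 zero    w (skip _ p) = contradiction (∷ˡ⁻ p) (1∉map-up w)
before-1 zero    w (refl ∷ p) = contradiction p (1∉map-up w)
before-1 (suc m) w (skip _ p) = before-1 m w p
before-1 (suc m) w (refl ∷ _) = refl

module _ (m : ℕ) (w : List ℕ) where

  -- A word beginning with suc m zeros, and the word obtained from it by raising its positive letters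
  -- and inserting a 1 after those zeros. Raising the letters keeps the zeros within w.
  lowered raised : List ℕ
  lowered = zeros (suc m) List.++ w
  raised  = zeros (suc m) List.++ 1 ∷ List.map up w

  map-up-lowered : List.map up lowered ≡ zeros (suc m) List.++ List.map up w
  map-up-lowered = trans (List.map-++ up (zeros (suc m)) w) (cong (List._++ List.map up w) (List.map-replicate up (suc m) 0))

  occurs-raised : ∀ τ → Occurs lowered τ → Occurs raised τ
  occurs-raised (k , τ) (σ , σ⊆ , iso) = Vec.map up σ ,
    subst (_⊆ raised) (sym (Vec.toList-map up σ))
      (⊆-trans (map⁺ up σ⊆) (subst (_⊆ raised) (sym map-up-lowered) (++⁺ (⊆-refl {x = zeros (suc m)}) (skip 1 ⊆-refl)))) ,
    Equivalence.from (map-up-iso σ τ) iso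

  -- An occurrence that does not use the inserted letter comes from the original word.
  occurs-lowered : ∀ {k} (τ σ : Vec ℕ k) → toList σ ⊆ raised → All (_≢ 1) (toList σ) →
    OrderIsomorphic σ τ → Occurs lowered (k , τ)
  occurs-lowered τ σ σ⊆ σ≢1 iso
    with ⊆-map⁻ σ up lowered (subst (toList σ ⊆_) (sym map-up-lowered) (drop-1 (zeros (suc m)) σ≢1 σ⊆))
  ... | ρ , refl , ρ⊆ = ρ , ρ⊆ , Equivalence.to (map-up-iso ρ τ) iso

[011] [201] : Pattern
[011] = 3 , 0 ∷ 1 ∷ 1 ∷ []
[201] = 3 , 2 ∷ 0 ∷ 1 ∷ []

011-iso : ∀ {y} → 0 < y → OrderIsomorphic (0 ∷ y ∷ y ∷ []) (0 ∷ 1 ∷ 1 ∷ [])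
011-iso {y} 0<y = λ where
    zero zero → none (λ ()) (λ ()) , both refl refl
    zero (suc zero) → both 0<y z<s , none (ℕ.<⇒≢ 0<y) (λ ())
    zero (suc (suc zero)) → both 0<y z<s , none (ℕ.<⇒≢ 0<y) (λ ())
    (suc zero) zero → none (λ ()) (λ ()) , none (ℕ.<⇒≢ 0<y ∘ sym) (λ ())
    (suc (suc zero)) zero → none (λ ()) (λ ()) , none (ℕ.<⇒≢ 0<y ∘ sym) (λ ())
    (suc zero) (suc zero) → same
    (suc zero) (suc (suc zero)) → same
    (suc (suc zero)) (suc zero) → same
    (suc (suc zero)) (suc (suc zero)) → same
  where
  both : {A B : Set} → A → B → A ⇔ B
  both a b = mk⇔ (λ _ → b) (λ _ → a)
  none : {A B : Set} → ¬ A → ¬ B → A ⇔ B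
  none ¬a ¬b = mk⇔ (λ a → contradiction a ¬a) (λ b → contradiction b ¬b)
  same : (y < y ⇔ 1 < 1) × (y ≡ y ⇔ 1 ≡ 1)
  same = none (ℕ.<-irrefl refl) (ℕ.<-irrefl refl) , both refl refl

iso-< : ∀ {k} (σ τ : Vec ℕ k) → OrderIsomorphic σ τ → ∀ a b → lookup τ a < lookup τ b → lookup σ a < lookup σ b
iso-< _ _ iso a b = Equivalence.from (proj₁ (iso a b))

iso-≡ : ∀ {k} (σ τ : Vec ℕ k) → OrderIsomorphic σ τ → ∀ a b → lookup τ a ≡ lookup τ b → lookup σ a ≡ lookup σ b
iso-≡ _ _ iso a b = Equivalence.from (proj₂ (iso a b))

module _ (m : ℕ) (w : List ℕ) where

  -- The first letter of an occurrence of 011 can be taken to be the leading 0, and the other two are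
  -- not 1, since only zeros precede the letter 1.
  lower-011 : Occurs (raised m w) [011] → Occurs (lowered m w) [011]
  lower-011 (x ∷ y ∷ z ∷ [] , p , iso)
    with iso-< (x ∷ y ∷ z ∷ []) (proj₂ [011]) iso zero (suc zero) z<s | iso-≡ (x ∷ y ∷ z ∷ []) (proj₂ [011]) iso (suc zero) (suc (suc zero)) refl
  ... | x<y | refl = occurs-lowered m w (proj₂ [011]) (0 ∷ y ∷ y ∷ []) (from-0 p) ((λ ()) ∷ y≢1 ∷ y≢1 ∷ []) (011-iso 0<y)
    where
    0<y : 0 < y
    0<y = ℕ.≤-<-trans z≤n x<y
    from-0 : x ∷ y ∷ y ∷ [] ⊆ raised m w → 0 ∷ y ∷ y ∷ [] ⊆ raised m w
    from-0 (skip _ q) = refl ∷ ∷ˡ⁻ q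
    from-0 (refl ∷ q) = refl ∷ q
    y≢1 : y ≢ 1
    y≢1 refl with before-1 (suc m) w (∷ˡ⁻ p)
    ... | ()

  -- The letters c > b > a of an occurrence of 201, in the order c, a, b, all differ from 1: c is at
  -- least 2, and a and b come after the nonzero letter c.
  lower-201 : Occurs (raised m w) [201] → Occurs (lowered m w) [201]
  lower-201 (c ∷ a ∷ b ∷ [] , p , iso) = occurs-lowered m w (proj₂ [201]) (c ∷ a ∷ b ∷ []) p (c≢1 ∷ a≢1 ∷ b≢1 ∷ []) iso
    where
    a<b : a < b
    a<b = iso-< (c ∷ a ∷ b ∷ []) (proj₂ [201]) iso (suc zero) (suc (suc zero)) (s≤s z≤n)
    b<c : b < c
    b<c = iso-< (c ∷ a ∷ b ∷ []) (proj₂ [201]) iso (suc (suc zero)) zero (s≤s (s≤s z≤n))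
    0<b : 0 < b
    0<b = ℕ.≤-<-trans z≤n a<b
    c≢0 : c ≢ 0
    c≢0 = ℕ.>⇒≢ (ℕ.<-trans 0<b b<c)
    c≢1 : c ≢ 1
    c≢1 refl = ℕ.<⇒≱ b<c 0<b
    a≢1 : a ≢ 1
    a≢1 refl = c≢0 (before-1 (suc m) w p)
    b≢1 : b ≢ 1
    b≢1 refl = c≢0 (before-1 (suc m) w (⊆-trans (refl ∷ skip a ⊆-refl) p))

[011,201] : List Pattern
[011,201] = [011] ∷ [201] ∷ []

-- The word d arises from e by inserting a letter 1 into it as above. The relation is stated on the
-- underlying lists, so that appending a letter needs no transport along an equation of lengths.
data Raised {n} (d : Vec ℕ (suc n)) (e : Vec ℕ n) : Set where
  mkRaised : ∀ m w → toList d ≡ raised m w → toList e ≡ lowered m w → Raised d e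

avoids-raised : ∀ {n} {d : Vec ℕ (suc n)} {e : Vec ℕ n} → Raised d e → Avoids [011,201] d ⇔ Avoids [011,201] e
avoids-raised {d = d} {e} (mkRaised m w d≡ e≡) = mk⇔
  (λ { (¬011 ∷ ¬201 ∷ []) → ¬011 ∘ raise [011] ∷ ¬201 ∘ raise [201] ∷ [] })
  (λ { (¬011 ∷ ¬201 ∷ []) → ¬011 ∘ lower [011] (lower-011 m w) ∷ ¬201 ∘ lower [201] (lower-201 m w) ∷ [] })
  where
  raise : ∀ τ → Contains e τ → Contains d τ
  raise τ = Equivalence.from (contains⇔occurs d τ) ∘ subst (λ l → Occurs l τ) (sym d≡) ∘ occurs-raised m w τ
    ∘ subst (λ l → Occurs l τ) e≡ ∘ Equivalence.to (contains⇔occurs e τ)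
  lower : ∀ τ → (Occurs (raised m w) τ → Occurs (lowered m w) τ) → Contains d τ → Contains e τ
  lower τ low = Equivalence.from (contains⇔occurs e τ) ∘ subst (λ l → Occurs l τ) (sym e≡) ∘ low
    ∘ subst (λ l → Occurs l τ) d≡ ∘ Equivalence.to (contains⇔occurs d τ)

raised-∷ʳ : ∀ {n} {d : Vec ℕ (suc n)} {e : Vec ℕ n} → Raised d e → ∀ j → Raised (d ∷ʳ up j) (e ∷ʳ j)
raised-∷ʳ {d = d} {e} (mkRaised m w d≡ e≡) j = mkRaised m (w List.++ j ∷ []) d′ e′
  where
  open ≡-Reasoning
  e′ : toList (e ∷ʳ j) ≡ lowered m (w List.++ j ∷ [])
  e′ = begin
    toList (e ∷ʳ j)             ≡⟨ toList-∷ʳ e j ⟩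
    toList e List.++ j ∷ []     ≡⟨ cong (List._++ j ∷ []) e≡ ⟩
    lowered m w List.++ j ∷ []  ≡⟨ List.++-assoc (zeros (suc m)) w (j ∷ []) ⟩
    lowered m (w List.++ j ∷ []) ∎
  d′ : toList (d ∷ʳ up j) ≡ raised m (w List.++ j ∷ [])
  d′ = begin
    toList (d ∷ʳ up j)             ≡⟨ toList-∷ʳ d (up j) ⟩
    toList d List.++ up j ∷ []     ≡⟨ cong (List._++ up j ∷ []) d≡ ⟩
    raised m w List.++ up j ∷ []   ≡⟨ List.++-assoc (zeros (suc m)) (1 ∷ List.map up w) (up j ∷ []) ⟩
    zeros (suc m) List.++ 1 ∷ (List.map up w List.++ up j ∷ []) ≡⟨ cong (λ v → zeros (suc m) List.++ 1 ∷ v) (List.map-++ up w (j ∷ [])) ⟨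
    raised m (w List.++ j ∷ []) ∎

-- A second letter 1 completes an occurrence of 011.
raised-∷ʳ-1 : ∀ {n} {d : Vec ℕ (suc n)} {e : Vec ℕ n} → Raised d e → Occurs (toList (d ∷ʳ 1)) [011]
raised-∷ʳ-1 {d = d} (mkRaised m w d≡ _) = 0 ∷ 1 ∷ 1 ∷ [] ,
  subst (0 ∷ 1 ∷ 1 ∷ [] ⊆_) (sym (trans (toList-∷ʳ d 1) (cong (List._++ 1 ∷ []) d≡)))
    (++⁺ (refl ∷ skip-zeros m) (⊆-refl {x = 1 ∷ []})) ,
  011-iso z<s
  where
  skip-zeros : ∀ m → 1 ∷ [] ⊆ zeros m List.++ 1 ∷ List.map up w
  skip-zeros zero    = refl ∷ minimum _
  skip-zeros (suc m) = skip 0 (skip-zeros m)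

-- The subtrees below d and e are isomorphic: the child of e with last letter j corresponds to the child
-- of d with last letter up j, and the remaining child of d, with last letter 1, contributes nothing.
extend-raised : ∀ ℓ {n} {d : Vec ℕ (suc n)} {e : Vec ℕ n} → Raised d e →
  extend (avoiding [011,201]) ℓ d ≡ extend (avoiding [011,201]) ℓ e
extend-raised zero    {d = d} {e} r = indicator-⇔ (avoids? [011,201] d) (avoids? [011,201] e) (avoids-raised r)
extend-raised (suc ℓ) {n} {d} {e} r = cong₂ ℕ._+_ (extend-raised ℓ (raised-∷ʳ r 0))
  (trans (cong (ℕ._+ ∑< n λ j → extend (avoiding [011,201]) ℓ (d ∷ʳ (2 ℕ.+ j))) (extend-occurs [011,201] (here refl) ℓ (d ∷ʳ 1) (raised-∷ʳ-1 r)))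
    (∑<-cong n λ j → extend-raised ℓ (raised-∷ʳ r (suc j))))

toList-zeros : ∀ m → toList (replicate m 0) ≡ zeros m
toList-zeros zero    = refl
toList-zeros (suc m) = cong (0 ∷_) (toList-zeros m)

zeros-raised : ∀ m → Raised (replicate (suc m) 0 ∷ʳ 1) (replicate (suc m) 0)
zeros-raised m = mkRaised m []
  (trans (toList-∷ʳ (replicate (suc m) 0) 1) (cong (List._++ 1 ∷ []) (toList-zeros (suc m))))
  (trans (toList-zeros (suc m)) (sym (List.++-identityʳ (zeros (suc m)))))

zeros-∷ʳ : ∀ m → replicate m 0 ∷ʳ 0 ≡ replicate (suc m) 0
zeros-∷ʳ zero    = refl
zeros-∷ʳ (suc m) = cong (0 ∷_) (zeros-∷ʳ m)

-- A constant word contains no pattern with two distinct letters.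
zeros-avoids : ∀ m → Avoids [011,201] (replicate m 0)
zeros-avoids m = absent [011] zero (suc zero) z<s ∷ absent [201] (suc zero) zero z<s ∷ []
  where
  absent : ∀ ((k , τ) : Pattern) a b → lookup τ a < lookup τ b → ¬ Contains (replicate m 0) (k , τ)
  absent (k , τ) a b τa<τb (is , _ , iso) = contradiction
    (subst₂ _<_ (entry a) (entry b) (iso-< (Vec.map (lookup (replicate m 0)) is) τ iso a b τa<τb)) λ ()
    where
    entry : ∀ a → lookup (Vec.map (lookup (replicate m 0)) is) a ≡ 0
    entry a = trans (Vec.lookup-map a _ is) (Vec.lookup-replicate (lookup is a) 0)

zeros-inversion : ∀ m → IsInversionSequence (replicate m 0)
zeros-inversion m i = subst (_≤ toℕ i) (sym (Vec.lookup-replicate i 0)) z≤n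

zeros-∷ʳ-inversion : ∀ m {j} → j ≤ m → IsInversionSequence (replicate m 0 ∷ʳ j)
zeros-∷ʳ-inversion m {j} j≤m = Equivalence.from (lookup-∷ʳ-≤ id (replicate m 0) j) (zeros-inversion m , j≤m)

-- The numbers of nodes ℓ levels below the word of suc m zeros, and of nodes ℓ levels below its
-- children 0...0j with j from 2 to suc m.
nodes siblings : ℕ → ℕ → ℕ
nodes m ℓ = extend (avoiding [011,201]) ℓ (replicate (suc m) 0)
siblings m ℓ = ∑< m λ j → extend (avoiding [011,201]) ℓ (replicate (suc m) 0 ∷ʳ (2 ℕ.+ j))

nodes-zero : ∀ m → nodes m 0 ≡ 1
nodes-zero m = indicator-yes (avoids? [011,201] (replicate (suc m) 0)) (zeros-avoids (suc m))

-- The children of the word of suc m zeros end in 0, in 1, or in a letter from 2 to suc m.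
nodes-suc : ∀ ℓ m → nodes m (suc ℓ) ≡ siblings m ℓ ℕ.+ nodes (suc m) ℓ ℕ.+ nodes m ℓ
nodes-suc ℓ m = begin
  extend (avoiding [011,201]) ℓ (0ᵐ ∷ʳ 0) ℕ.+ (extend (avoiding [011,201]) ℓ (0ᵐ ∷ʳ 1) ℕ.+ siblings m ℓ)
    ≡⟨ cong₂ (λ a b → a ℕ.+ (b ℕ.+ siblings m ℓ))
         (cong (λ (e : Vec ℕ (2 ℕ.+ m)) → extend (avoiding [011,201]) ℓ e) (zeros-∷ʳ (suc m)))
         (extend-raised ℓ (zeros-raised m)) ⟩
  nodes (suc m) ℓ ℕ.+ (nodes m ℓ ℕ.+ siblings m ℓ)
    ≡⟨ rearrange (nodes (suc m) ℓ) (nodes m ℓ) (siblings m ℓ) ⟩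
  siblings m ℓ ℕ.+ nodes (suc m) ℓ ℕ.+ nodes m ℓ
    ∎
  where
  open ≡-Reasoning
  0ᵐ : Vec ℕ (suc m)
  0ᵐ = replicate (suc m) 0
  rearrange : ∀ a b s → a ℕ.+ (b ℕ.+ s) ≡ s ℕ.+ a ℕ.+ b
  rearrange a b s = trans (sym (ℕ.+-assoc a b s)) (trans (ℕ.+-comm (a ℕ.+ b) s) (sym (ℕ.+-assoc s a b)))

-- The semiring of power series

-- The series (f - f 0) / x.
shift : Series → Series
shift f n = f (suc n)

infixr 8 _·_
_·_ : ℤ → Series → Series
(c · f) n = c ℤ.* f n

*-congʳ-≤ : ∀ f {g h} n → (∀ m → m ≤ n → g m ≡ h m) → (f * g) n ≡ (f * h) n
*-congʳ-≤ f n eq = sum-cong-≗ {suc n} λ i → cong (f (toℕ i) ℤ.*_) (eq _ (ℕ.m∸n≤m n (toℕ i)))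

*-cong : ∀ {f f′ g g′} → f ≗ f′ → g ≗ g′ → f * g ≗ f′ * g′
*-cong p q n = sum-cong-≗ {suc n} λ i → cong₂ ℤ._*_ (p (toℕ i)) (q (n ∸ toℕ i))

*-distribʳ-+ : ∀ h f g → (f + g) * h ≗ f * h + g * h
*-distribʳ-+ h f g n = trans
  (sum-cong-≗ {suc n} λ i → ℤ.*-distribʳ-+ (h (n ∸ toℕ i)) (f (toℕ i)) (g (toℕ i)))
  (∑-distrib-+ {suc n} (λ i → f (toℕ i) ℤ.* h (n ∸ toℕ i)) (λ i → g (toℕ i) ℤ.* h (n ∸ toℕ i)))

·-*-assoc : ∀ c f g → (c · f) * g ≗ c · (f * g)
·-*-assoc c f g n = trans
  (sum-cong-≗ {suc n} λ i → ℤ.*-assoc c (f (toℕ i)) (g (n ∸ toℕ i)))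
  (sym (*-distribˡ-sum {suc n} c λ i → f (toℕ i) ℤ.* g (n ∸ toℕ i)))

const-0 : ∀ n → const 0ℤ n ≡ 0ℤ
const-0 zero    = refl
const-0 (suc _) = refl

shift-const : ∀ c → shift (const c) ≗ const 0ℤ
shift-const c n = sym (const-0 n)

*-zeroˡ : ∀ f → const 0ℤ * f ≗ const 0ℤ
*-zeroˡ f zero    = refl
*-zeroˡ f (suc n) = begin
  0ℤ ℤ.+ (shift (const 0ℤ) * f) n  ≡⟨ ℤ.+-identityˡ _ ⟩
  (shift (const 0ℤ) * f) n         ≡⟨ *-cong {g = f} (shift-const 0ℤ) (λ _ → refl) n ⟩
  (const 0ℤ * f) n                 ≡⟨ *-zeroˡ f n ⟩
  const 0ℤ n                       ≡⟨ const-0 n ⟩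
  0ℤ                               ∎
  where open ≡-Reasoning

*-assoc : ∀ f g h → (f * g) * h ≗ f * (g * h)
*-assoc f g h zero    = solve₀ (f 0) (g 0) (h 0)
  where
  solve₀ : ∀ a b c → (a ℤ.* b ℤ.+ 0ℤ) ℤ.* c ℤ.+ 0ℤ ≡ a ℤ.* (b ℤ.* c ℤ.+ 0ℤ) ℤ.+ 0ℤ
  solve₀ = solve-∀
*-assoc f g h (suc n) = begin
  (f * g) 0 ℤ.* h (suc n) ℤ.+ (shift (f * g) * h) n
    ≡⟨ cong (λ z → (f * g) 0 ℤ.* h (suc n) ℤ.+ z) (*-distribʳ-+ h (f 0 · shift g) (shift f * g) n) ⟩
  (f * g) 0 ℤ.* h (suc n) ℤ.+ (((f 0 · shift g) * h) n ℤ.+ ((shift f * g) * h) n)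
    ≡⟨ cong₂ (λ z w → (f * g) 0 ℤ.* h (suc n) ℤ.+ (z ℤ.+ w)) (·-*-assoc (f 0) (shift g) h n) (*-assoc (shift f) g h n) ⟩
  (f * g) 0 ℤ.* h (suc n) ℤ.+ (f 0 ℤ.* (shift g * h) n ℤ.+ (shift f * (g * h)) n)
    ≡⟨ rearrange (f 0) (g 0) (h (suc n)) ((shift g * h) n) ((shift f * (g * h)) n) ⟩
  f 0 ℤ.* (g 0 ℤ.* h (suc n) ℤ.+ (shift g * h) n) ℤ.+ (shift f * (g * h)) n
    ∎
  where
  open ≡-Reasoning
  rearrange : ∀ a b c d e → (a ℤ.* b ℤ.+ 0ℤ) ℤ.* c ℤ.+ (a ℤ.* d ℤ.+ e) ≡ a ℤ.* (b ℤ.* c ℤ.+ d) ℤ.+ e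
  rearrange = solve-∀

-- The convolution expanded at its last term rather than at its first.
*-sucʳ : ∀ f g n → (f * g) (suc n) ≡ f (suc n) ℤ.* g 0 ℤ.+ (f * shift g) n
*-sucʳ f g zero    = swap (f 0) (g 1) (f 1) (g 0)
  where
  swap : ∀ a b c d → a ℤ.* b ℤ.+ (c ℤ.* d ℤ.+ 0ℤ) ≡ c ℤ.* d ℤ.+ (a ℤ.* b ℤ.+ 0ℤ)
  swap = solve-∀
*-sucʳ f g (suc n) = begin
  f 0 ℤ.* g (2 ℕ.+ n) ℤ.+ (shift f * g) (suc n)
    ≡⟨ cong (λ z → f 0 ℤ.* g (2 ℕ.+ n) ℤ.+ z) (*-sucʳ (shift f) g n) ⟩
  f 0 ℤ.* g (2 ℕ.+ n) ℤ.+ (f (2 ℕ.+ n) ℤ.* g 0 ℤ.+ (shift f * shift g) n)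
    ≡⟨ swap (f 0 ℤ.* g (2 ℕ.+ n)) (f (2 ℕ.+ n) ℤ.* g 0) ((shift f * shift g) n) ⟩
  f (2 ℕ.+ n) ℤ.* g 0 ℤ.+ (f 0 ℤ.* g (2 ℕ.+ n) ℤ.+ (shift f * shift g) n)
    ∎
  where
  open ≡-Reasoning
  swap : ∀ a b c → a ℤ.+ (b ℤ.+ c) ≡ b ℤ.+ (a ℤ.+ c)
  swap = solve-∀

*-comm : ∀ f g → f * g ≗ g * f
*-comm f g zero    = cong (ℤ._+ 0ℤ) (ℤ.*-comm (f 0) (g 0))
*-comm f g (suc n) = trans
  (cong₂ ℤ._+_ (ℤ.*-comm (f 0) (g (suc n))) (*-comm (shift f) g n))
  (sym (*-sucʳ g f n))

*-identityˡ : ∀ f → const 1ℤ * f ≗ f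
*-identityˡ f zero    = trans (ℤ.+-identityʳ _) (ℤ.*-identityˡ (f 0))
*-identityˡ f (suc n) = begin
  1ℤ ℤ.* f (suc n) ℤ.+ (shift (const 1ℤ) * f) n  ≡⟨ cong₂ ℤ._+_ (ℤ.*-identityˡ (f (suc n))) (*-cong {g = f} (shift-const 1ℤ) (λ _ → refl) n) ⟩
  f (suc n) ℤ.+ (const 0ℤ * f) n                 ≡⟨ cong (λ z → f (suc n) ℤ.+ z) (trans (*-zeroˡ f n) (const-0 n)) ⟩
  f (suc n) ℤ.+ 0ℤ                               ≡⟨ ℤ.+-identityʳ _ ⟩
  f (suc n)                                      ∎
  where open ≡-Reasoning

seriesSemiring : CommutativeSemiring 0ℓ 0ℓ
seriesSemiring = record
  { Carrier = Series ; _≈_ = _≗_ ; _+_ = _+_ ; _*_ = _*_ ; 0# = const 0ℤ ; 1# = const 1ℤ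
  ; isCommutativeSemiring = Biased.IsCommutativeSemiringˡ.isCommutativeSemiring record
    { +-isCommutativeMonoid = Biased.IsCommutativeMonoidˡ.isCommutativeMonoid record
      { isSemigroup = record
        { isMagma = record { isEquivalence = ≗-isEquivalence ; ∙-cong = λ p q n → cong₂ ℤ._+_ (p n) (q n) }
        ; assoc = λ f g h n → ℤ.+-assoc (f n) (g n) (h n)
        }
      ; identityˡ = λ f n → trans (cong (ℤ._+ f n) (const-0 n)) (ℤ.+-identityˡ (f n))
      ; comm = λ f g n → ℤ.+-comm (f n) (g n)
      }
    ; *-isCommutativeMonoid = Biased.IsCommutativeMonoidˡ.isCommutativeMonoid record
      { isSemigroup = record { isMagma = record { isEquivalence = ≗-isEquivalence ; ∙-cong = *-cong } ; assoc = *-assoc }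
      ; identityˡ = *-identityˡ
      ; comm = *-comm
      }
    ; distribʳ = *-distribʳ-+
    ; zeroˡ = *-zeroˡ
    }
  }
  where
  ≗-isEquivalence : IsEquivalence {A = Series} _≗_
  ≗-isEquivalence = record { refl = λ _ → refl ; sym = λ p n → sym (p n) ; trans = λ p q n → trans (p n) (q n) }

module S = CommutativeSemiring seriesSemiring
open SemiringSolver seriesSemiring using (solve; _:=_; _:+_; _:*_; con)

-- Series without constant term, quotients and substitution

guarded-head : ∀ g → g 0 ≡ 0ℤ → ∀ f → (g * f) 0 ≡ 0ℤ
guarded-head g g₀ f = trans (ℤ.+-identityʳ _) (cong (ℤ._* f 0) g₀)

guarded-tail : ∀ g → g 0 ≡ 0ℤ → ∀ f → shift (g * f) ≗ shift g * f
guarded-tail g g₀ f n = trans (cong (λ z → z ℤ.* f (suc n) ℤ.+ (shift g * f) n) g₀) (ℤ.+-identityˡ _)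

X*-suc : ∀ f n → (X * f) (suc n) ≡ f n
X*-suc f n = trans (guarded-tail X refl f n) (trans (*-cong {g = f} shift-X (λ _ → refl) n) (*-identityˡ f n))
  where
  shift-X : shift X ≗ const 1ℤ
  shift-X zero    = refl
  shift-X (suc _) = refl

-- Long division gives the only quotient.
/-unique : ∀ {f g h} → g 0 ≡ 1ℤ → f * g ≗ h → f ≗ h / g
/-unique {f} {g} {h} g₀ eq zero = trans (sym (ℤ.*-identityʳ (f 0)))
  (trans (cong (f 0 ℤ.*_) (sym g₀)) (trans (sym (ℤ.+-identityʳ _)) (eq 0)))
/-unique {f} {g} {h} g₀ eq (suc n) = /-unique {shift f} {g} g₀ eq′ n
  where
  cancel : ∀ a b c → a ≡ b ℤ.+ c → c ≡ a ℤ.- b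
  cancel a b c refl = lem b c
    where
    lem : ∀ b c → c ≡ b ℤ.+ c ℤ.- b
    lem = solve-∀
  eq′ : shift f * g ≗ λ m → h (suc m) ℤ.- h 0 ℤ.* g (suc m)
  eq′ m = cancel (h (suc m)) (h 0 ℤ.* g (suc m)) _
    (trans (sym (eq (suc m))) (cong (λ z → z ℤ.* g (suc m) ℤ.+ (shift f * g) m) (/-unique {f} g₀ eq 0)))

-- Such a system of equations has at most one solution: the coefficient of x^n on the right-hand side
-- involves F (suc m) only through its coefficients below x^n. The induction is on a bound N for n,
-- simultaneously for all m.
guarded-unique : ∀ g → g 0 ≡ 0ℤ → (F G K : ℕ → Series) →
  (∀ m → F m ≗ g * (K m + F (suc m))) → (∀ m → G m ≗ g * (K m + G (suc m))) →
  ∀ m → F m ≗ G m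
guarded-unique g g₀ F G K p q m n = below (suc n) n ℕ.≤-refl m
  where
  open ≡-Reasoning
  below : ∀ N n → n < N → ∀ m → F m n ≡ G m n
  below (suc N) zero    _         m = begin
    F m 0                        ≡⟨ p m 0 ⟩
    (g * (K m + F (suc m))) 0    ≡⟨ guarded-head g g₀ (K m + F (suc m)) ⟩
    0ℤ                           ≡⟨ guarded-head g g₀ (K m + G (suc m)) ⟨
    (g * (K m + G (suc m))) 0    ≡⟨ q m 0 ⟨
    G m 0                        ∎
  below (suc N) (suc n) (s≤s n<N) m = begin
    F m (suc n)                       ≡⟨ p m (suc n) ⟩
    (g * (K m + F (suc m))) (suc n)   ≡⟨ guarded-tail g g₀ (K m + F (suc m)) n ⟩
    (shift g * (K m + F (suc m))) n   ≡⟨ *-congʳ-≤ (shift g) n (λ k k≤n → cong (λ z → K m k ℤ.+ z) (below N k (ℕ.<-≤-trans (s≤s k≤n) n<N) (suc m))) ⟩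
    (shift g * (K m + G (suc m))) n   ≡⟨ guarded-tail g g₀ (K m + G (suc m)) n ⟨
    (g * (K m + G (suc m))) (suc n)   ≡⟨ q m (suc n) ⟨
    G m (suc n)                       ∎

*-vanishes : ∀ f {g} n → (∀ m → m ≤ n → g m ≡ 0ℤ) → (f * g) n ≡ 0ℤ
*-vanishes f {g} n g≡0 = begin
  (f * g) n         ≡⟨ *-congʳ-≤ f n (λ m m≤n → trans (g≡0 m m≤n) (sym (const-0 m))) ⟩
  (f * const 0ℤ) n  ≡⟨ S.zeroʳ f n ⟩
  const 0ℤ n        ≡⟨ const-0 n ⟩
  0ℤ                ∎
  where open ≡-Reasoning

^-order : ∀ g → g 0 ≡ 0ℤ → ∀ k n → n < k → (g ^ k) n ≡ 0ℤ
^-order g g₀ (suc k) zero    _         = guarded-head g g₀ (g ^ k)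
^-order g g₀ (suc k) (suc n) (s≤s n<k) = trans (guarded-tail g g₀ (g ^ k) n)
  (*-vanishes (shift g) n λ m m≤n → ^-order g g₀ k m (ℕ.≤-<-trans m≤n n<k))

sum-truncate : ∀ {M N} (t : ℕ → ℤ) → M ≤ N → (∀ k → M ≤ k → t k ≡ 0ℤ) →
  sum {N} (t ∘ toℕ) ≡ sum {M} (t ∘ toℕ)
sum-truncate {N = N} t z≤n     t≡0 = trans (sum-cong-≗ {N} λ i → t≡0 (toℕ i) z≤n) (sum-replicate-zero N)
sum-truncate         t (s≤s p) t≡0 = cong (λ z → t 0 ℤ.+ z) (sum-truncate (t ∘ suc) p λ k q → t≡0 (suc k) (s≤s q))

-- The terms that evalSeries omits do not contribute, so any longer partial sum gives the same
-- coefficient.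
evalSeries-truncate : ∀ F g → g 0 ≡ 0ℤ → ∀ n N → n < N →
  evalSeries F g n ≡ sum {N} λ k → (F (toℕ k) * g ^ toℕ k) n
evalSeries-truncate F g g₀ n N n<N = sym (sum-truncate (λ k → (F k * g ^ k) n) n<N
  λ k n<k → *-vanishes (F k) n λ m m≤n → ^-order g g₀ k m (ℕ.≤-<-trans m≤n n<k))

*-distribˡ-∑ : ∀ f N (G : Fin N → Series) →
  f * (λ n → sum {N} λ k → G k n) ≗ λ n → sum {N} λ k → (f * G k) n
*-distribˡ-∑ f N G n = trans
  (sum-cong-≗ {suc n} λ i → *-distribˡ-sum {N} (f (toℕ i)) λ k → G k (n ∸ toℕ i))
  (∑-comm {suc n} {N} λ i k → f (toℕ i) ℤ.* G k (n ∸ toℕ i))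

evalSeries-horner : ∀ F g → g 0 ≡ 0ℤ → evalSeries F g ≗ F 0 + g * evalSeries (F ∘ suc) g
evalSeries-horner F g g₀ zero = cong₂ ℤ._+_ (S.*-identityʳ (F 0) 0) (sym (guarded-head g g₀ (evalSeries (F ∘ suc) g)))
evalSeries-horner F g g₀ (suc n) = cong₂ ℤ._+_ (S.*-identityʳ (F 0) (suc n)) (begin
  sum {suc n} (λ k → (F (suc (toℕ k)) * (g * g ^ toℕ k)) (suc n))
    ≡⟨ sum-cong-≗ {suc n} (λ k → swap (F (suc (toℕ k))) g (g ^ toℕ k) (suc n)) ⟩
  sum {suc n} (λ k → (g * (F (suc (toℕ k)) * g ^ toℕ k)) (suc n))
    ≡⟨ *-distribˡ-∑ g (suc n) (λ k → F (suc (toℕ k)) * g ^ toℕ k) (suc n) ⟨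
  (g * partialSum) (suc n)
    ≡⟨ guarded-tail g g₀ partialSum n ⟩
  (shift g * partialSum) n
    ≡⟨ *-congʳ-≤ (shift g) {evalSeries (F ∘ suc) g} {partialSum} n (λ m m≤n → evalSeries-truncate (F ∘ suc) g g₀ m (suc n) (s≤s m≤n)) ⟨
  (shift g * evalSeries (F ∘ suc) g) n
    ≡⟨ guarded-tail g g₀ (evalSeries (F ∘ suc) g) n ⟨
  (g * evalSeries (F ∘ suc) g) (suc n)
    ∎)
  where
  open ≡-Reasoning
  partialSum : Series
  partialSum m = sum {suc n} λ k → (F (suc (toℕ k)) * g ^ toℕ k) m
  swap : ∀ f g h → f * (g * h) ≗ g * (f * h)
  swap = solve 3 (λ f g h → f :* (g :* h) := g :* (f :* h)) S.refl

evalSeries-cong : ∀ {F G} g → (∀ k → F k ≗ G k) → evalSeries F g ≗ evalSeries G g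
evalSeries-cong g eq n = sum-cong-≗ {suc n} λ k → *-cong {g = g ^ toℕ k} (eq (toℕ k)) (λ _ → refl) n

-- Solving the recurrence

-- The equation q = f + g q of the geometric series q = f / (1 - g).
/-geometric : ∀ f g → g 0 ≡ 0ℤ → f / (const 1ℤ - g) ≗ f + g * (f / (const 1ℤ - g))
/-geometric f g g₀ = begin
  q                              ≈⟨ S.*-identityʳ q ⟨
  q * const 1ℤ                   ≈⟨ *-cong {q} (λ _ → refl) (λ n → minus-plus (const 1ℤ n) (g n)) ⟨
  q * ((const 1ℤ - g) + g)       ≈⟨ S.distribˡ q (const 1ℤ - g) g ⟩
  q * (const 1ℤ - g) + q * g     ≈⟨ S.+-cong (/-* f (const 1ℤ - g) (cong (λ z → 1ℤ ℤ.- z) g₀)) (*-comm q g) ⟩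
  f + g * q                      ∎
  where
  open SetoidReasoning S.setoid
  q : Series
  q = f / (const 1ℤ - g)
  minus-plus : ∀ a b → a ℤ.- b ℤ.+ b ≡ a
  minus-plus = solve-∀

-- The series x/(1-x), written y in the introduction.
Y : Series
Y = X / (const 1ℤ - X)

-- The equation a = X (f + a) has only the solution a = Y f.
Y-solves : ∀ f a → a ≗ X * (f + a) → a ≗ Y * f
Y-solves f a eq = guarded-unique X refl (λ _ → a) (λ _ → Y * f) (λ _ → f) (λ _ → eq) (λ _ → begin
  Y * f              ≈⟨ *-cong {g = f} (/-geometric X X refl) (λ _ → refl) ⟩
  (X + X * Y) * f    ≈⟨ solve 3 (λ x y f → (x :+ x :* y) :* f := x :* (f :+ y :* f)) S.refl X Y f ⟩
  X * (f + Y * f)    ∎) 0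
  where open SetoidReasoning S.setoid

const-2 : const (+ 2) ≗ const 1ℤ + const 1ℤ
const-2 zero    = refl
const-2 (suc _) = refl

Y² : X ^ 2 / (const 1ℤ - X) ^ 2 ≗ Y * Y
Y² = S.sym {Y * Y} (/-unique {Y * Y} {u ^ 2} {X ^ 2} refl (begin
  Y * Y * (u * (u * const 1ℤ))    ≈⟨ solve 2 (λ y u → y :* y :* (u :* (u :* con 1)) := (y :* u) :* (y :* u)) S.refl Y u ⟩
  (Y * u) * (Y * u)               ≈⟨ *-cong (/-* X u refl) (/-* X u refl) ⟩
  X * X                           ≈⟨ *-cong {X} (λ _ → refl) (S.*-identityʳ X) ⟨
  X * (X * const 1ℤ)              ∎))
  where
  open SetoidReasoning S.setoid
  u : Series
  u = const 1ℤ - X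

-- The family of equations a m = X (1 + s m + a (suc m) + a m), solved for a 0.
module _ (a s : ℕ → Series) (eq : ∀ m → a m ≗ X * ((const 1ℤ + s m + a (suc m)) + a m)) where

  private
    t : Series
    t = X / (const 1ℤ - const (+ 2) * X)

    -- The sum of s (m + k) Y^k over k.
    e : ℕ → Series
    e m = evalSeries (λ k → s (k ℕ.+ m)) Y

  open SetoidReasoning S.setoid

  t-eq : t ≗ Y * (const 1ℤ + t)
  t-eq = Y-solves (const 1ℤ + t) t (begin
    t                                    ≈⟨ /-geometric X (const (+ 2) * X) refl ⟩
    X + const (+ 2) * X * t              ≈⟨ S.+-congˡ {X} (*-cong {g = t} (*-cong {g = X} const-2 (λ _ → refl)) (λ _ → refl)) ⟩
    X + (const 1ℤ + const 1ℤ) * X * t    ≈⟨ solve 2 (λ x t → x :+ (con 1 :+ con 1) :* x :* t := x :* ((con 1 :+ t) :+ t)) S.refl X t ⟩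
    X * ((const 1ℤ + t) + t)             ∎)

  e-eq : ∀ m → e m ≗ s m + Y * e (suc m)
  e-eq m = begin
    e m
      ≈⟨ evalSeries-horner (λ k → s (k ℕ.+ m)) Y refl ⟩
    s m + Y * evalSeries (λ k → s (suc k ℕ.+ m)) Y
      ≈⟨ S.+-congˡ {s m} (*-cong {Y} (λ _ → refl) (evalSeries-cong Y λ k n → cong (λ i → s i n) (sym (ℕ.+-suc k m)))) ⟩
    s m + Y * e (suc m)                                  ∎

  solution : ∀ m → a m ≗ t + Y * e m
  solution = guarded-unique Y refl a (λ m → t + Y * e m) (λ m → const 1ℤ + s m)
    (λ m → Y-solves (const 1ℤ + s m + a (suc m)) (a m) (eq m))
    λ m → begin
      t + Y * e m
        ≈⟨ S.+-cong t-eq (*-cong {Y} (λ _ → refl) (e-eq m)) ⟩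
      Y * (const 1ℤ + t) + Y * (s m + Y * e (suc m))
        ≈⟨ solve 4 (λ y t s e → y :* (con 1 :+ t) :+ y :* (s :+ y :* e) := y :* ((con 1 :+ s) :+ (t :+ y :* e))) S.refl Y t (s m) (e (suc m)) ⟩
      Y * ((const 1ℤ + s m) + (t + Y * e (suc m)))        ∎

  solution₀ : s 0 ≗ const 0ℤ → a 0 ≗ t + X ^ 2 / (const 1ℤ - X) ^ 2 * evalSeries (λ k → s (suc k)) Y
  solution₀ s₀ = begin
    a 0                       ≈⟨ solution 0 ⟩
    t + Y * e 0               ≈⟨ S.+-congˡ {t} (*-cong {Y} (λ _ → refl) (e-eq 0)) ⟩
    t + Y * (s 0 + Y * e 1)   ≈⟨ S.+-congˡ {t} (*-cong {Y} (λ _ → refl) (S.+-congʳ {Y * e 1} s₀)) ⟩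
    t + Y * (const 0ℤ + Y * e 1)   ≈⟨ S.+-congˡ {t} (solve 2 (λ y e → y :* (con 0 :+ y :* e) := y :* y :* e) S.refl Y (e 1)) ⟩
    t + Y * Y * e 1           ≈⟨ S.+-congˡ {t} (*-cong Y² (evalSeries-cong Y λ k n → cong (λ i → s i n) (ℕ.+-comm 1 k))) ⟨
    t + X ^ 2 / (const 1ℤ - X) ^ 2 * evalSeries (λ k → s (suc k)) Y ∎

-- The generating functions of the tree

gf-cong : ∀ a b → a ≗ b → gf a ≗ gf b
gf-cong a b eq zero    = refl
gf-cong a b eq (suc n) = cong +_ (eq n)

evalPoly-1 : ∀ (a : ℕ → ℕ → ℕ) is → evalPoly (List.map (gf ∘ a) is) (const 1ℤ) ≗ gf λ ℓ → sumOver is λ i → a i ℓ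
evalPoly-1 a []       zero    = refl
evalPoly-1 a []       (suc n) = refl
evalPoly-1 a (i ∷ is) n       = trans
  (cong (λ z → gf (a i) n ℤ.+ z) (trans (*-identityˡ (evalPoly (List.map (gf ∘ a) is) (const 1ℤ)) n) (evalPoly-1 a is n)))
  (gf-+ n)
  where
  gf-+ : gf (a i) + gf (λ ℓ → sumOver is λ i → a i ℓ) ≗ gf λ ℓ → sumOver (i ∷ is) λ i → a i ℓ
  gf-+ zero    = refl
  gf-+ (suc n) = refl

-- The series of nodes satisfies the recurrence; the term 1 accounts for the root of the subtree.
gf-recurrence : ∀ (a s : ℕ → ℕ → ℕ) → (∀ m → a m 0 ≡ 1) →
  (∀ ℓ m → a m (suc ℓ) ≡ s m ℓ ℕ.+ a (suc m) ℓ ℕ.+ a m ℓ) →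
  ∀ m → gf (a m) ≗ X * ((const 1ℤ + gf (s m) + gf (a (suc m))) + gf (a m))
gf-recurrence a s a₀ a₁ m zero    = sym (guarded-head X refl (const 1ℤ + gf (s m) + gf (a (suc m)) + gf (a m)))
gf-recurrence a s a₀ a₁ m (suc n) = trans (level n) (sym (X*-suc (const 1ℤ + gf (s m) + gf (a (suc m)) + gf (a m)) n))
  where
  level : ∀ n → + a m n ≡ (const 1ℤ + gf (s m) + gf (a (suc m)) + gf (a m)) n
  level zero    = cong +_ (a₀ m)
  level (suc ℓ) = cong +_ (a₁ ℓ m)

-- The letters j = 2 + k - i are listed in decreasing order in B P k, and summed in increasing order here.
B-gf : ∀ P k → evalPoly (B P k) (const 1ℤ) ≗ gf λ ℓ → ∑< (suc k) λ j → extend (avoiding P) ℓ (replicate (2 ℕ.+ k) 0 ∷ʳ (2 ℕ.+ j))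
B-gf P k n = trans
  (evalPoly-1 (λ i ℓ → length (descendants P (node i) ℓ)) (upTo (suc k)) n)
  (gf-cong (λ ℓ → sumOver (upTo (suc k)) λ i → length (descendants P (node i) ℓ)) _ count n)
  where
  open ≡-Reasoning
  node : ℕ → Vec ℕ (3 ℕ.+ k)
  node i = replicate (2 ℕ.+ k) 0 ∷ʳ (2 ℕ.+ k ∸ i)
  count : ∀ ℓ → sumOver (upTo (suc k)) (λ i → length (descendants P (node i) ℓ)) ≡
    ∑< (suc k) λ j → extend (avoiding P) ℓ (replicate (2 ℕ.+ k) 0 ∷ʳ (2 ℕ.+ j))
  count ℓ = begin
    sumOver (upTo (suc k)) (λ i → length (descendants P (node i) ℓ))
      ≡⟨ sumOver-cong (λ i → length-descendants P (node i) (zeros-∷ʳ-inversion (2 ℕ.+ k) (ℕ.m∸n≤m (2 ℕ.+ k) i)) ℓ) (upTo (suc k)) ⟩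
    sumOver (upTo (suc k)) (λ i → extend (avoiding P) ℓ (node i))
      ≡⟨ cong ℕ.sum (List.map-upTo (λ i → extend (avoiding P) ℓ (node i)) (suc k)) ⟩
    ∑< (suc k) (λ i → extend (avoiding P) ℓ (node i))
      ≡⟨ ∑<-reverse (λ j → extend (avoiding P) ℓ (replicate (2 ℕ.+ k) 0 ∷ʳ j)) k ⟩
    ∑< (suc k) (λ j → extend (avoiding P) ℓ (replicate (2 ℕ.+ k) 0 ∷ʳ (2 ℕ.+ j)))
      ∎

A-gf : ∀ P m → A P m ≗ gf λ ℓ → extend (avoiding P) ℓ (replicate (suc m) 0)
A-gf P m = gf-cong (λ ℓ → length (descendants P (replicate (suc m) 0) ℓ)) _ (length-descendants P (replicate (suc m) 0) (zeros-inversion (suc m)))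

A⟨0⟩ : ∀ P → evalSeries (A P) (const 0ℤ) ≗ A P 0
A⟨0⟩ P = begin
  evalSeries (A P) (const 0ℤ)                                  ≈⟨ evalSeries-horner (A P) (const 0ℤ) refl ⟩
  A P 0 + const 0ℤ * evalSeries (A P ∘ suc) (const 0ℤ)  ≈⟨ S.+-congˡ {A P 0} (*-zeroˡ (evalSeries (A P ∘ suc) (const 0ℤ))) ⟩
  A P 0 + const 0ℤ                                             ≈⟨ S.+-identityʳ (A P 0) ⟩
  A P 0                                                        ∎
  where open SetoidReasoning S.setoid

siblings-0 : gf (siblings 0) ≗ const 0ℤ
siblings-0 zero    = refl
siblings-0 (suc n) = refl

theorem4p11 : let P : List Pattern
                  P = (3 , 0 ∷ 1 ∷ 1 ∷ []) ∷ (3 , 2 ∷ 0 ∷ 1 ∷ []) ∷ []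
                  A⟨x,0⟩ = evalSeries (A P) (const (+ 0))
                  B⟨x,x/1-x,1⟩ = evalSeries (λ k → evalPoly (B P k) (const (+ 1))) (X / (const (+ 1) - X))
              in (gf (λ n → length (I n P)) ≗ A⟨x,0⟩)
                 × (A⟨x,0⟩ ≗ X / (const (+ 1) - const (+ 2) * X) + X ^ 2 / (const (+ 1) - X) ^ 2 * B⟨x,x/1-x,1⟩)
theorem4p11 =
  (λ n → trans (gf-cong (λ n → length (I n [011,201])) (nodes 0) (length-I [011,201]) n)
    (sym (trans (A⟨0⟩ [011,201] n) (A-gf [011,201] 0 n)))) ,
  (begin
  evalSeries (A [011,201]) (const 0ℤ)
    ≈⟨ A⟨0⟩ [011,201] ⟩
  A [011,201] 0
    ≈⟨ A-gf [011,201] 0 ⟩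
  gf (nodes 0)
    ≈⟨ solution₀ (gf ∘ nodes) (gf ∘ siblings) (gf-recurrence nodes siblings nodes-zero nodes-suc) siblings-0 ⟩
  X / (const 1ℤ - const (+ 2) * X) + X ^ 2 / (const 1ℤ - X) ^ 2 * evalSeries (gf ∘ siblings ∘ suc) Y
    ≈⟨ S.+-congˡ {X / (const 1ℤ - const (+ 2) * X)} (*-cong {X ^ 2 / (const 1ℤ - X) ^ 2} (λ _ → refl)
         (evalSeries-cong Y λ k n → sym (B-gf [011,201] k n))) ⟩
  X / (const 1ℤ - const (+ 2) * X) + X ^ 2 / (const 1ℤ - X) ^ 2 * evalSeries (λ k → evalPoly (B [011,201] k) (const 1ℤ)) Y
    ∎)
  where open SetoidReasoning S.setoid
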